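{- For every integer $t\ge1$, there are an integer $n$ and, with $G=\mathbb F_2^n$, equal-size subspaces $H_0,H_1\le G$ and one nonempty set $B\subseteq G$ such that $$|H_i+H_i|=|H_i|,\qquad |H_i\triangle B|=(1-2^{ -t})|H_i|\qquad(i\in\{0,1\}),$$ and $$\min_{\substack{V\le G\\ |V|\le|H_0|}}\ \max\left\{\mathcal N_V(H_0),\mathcal N_V(H_1)\right\}=2^{\lceil t/2\rceil},$$ where the minimum is over subspaces $V\leq G$ with $|V|\le|H_0|$.
   Context: For $S,T\subseteq\mathbb F_2^n$, $S+T=\{s+t:s\in S,t\in T\}$; $\triangle$ is symmetric difference. For a subspace $V\le\mathbb F_2^n$ and a set $S$, $\mathcal N_V(S)=\min\{|T|:S\subseteq T+V\}$ is the minimum number of $V$-cosets needed to cover $S$. -}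

module Defs where

open import Data.Bool.Base using (Bool; true; false; _∧_; _xor_; T)
open import Data.Bool.ListAction using (any)
import Data.Bool.Properties as Bool
open import Data.Integer.Base using (+_)
open import Data.List.Base using (List; []; _∷_; _++_; map; length; filterᵇ)
open import Data.Nat.Base using (ℕ; zero; suc; _≤_; _^_)
open import Data.Nat.Properties using (m^n≢0)
open import Data.Product using (_×_; ∃-syntax)
open import Data.Rational.Base using (ℚ; _/_)
open import Data.Vec.Base as Vec using (Vec; zipWith; replicate)
open import Data.Vec.Properties using (≡-dec)
open import Relation.Binary.PropositionalEquality using (_≡_)
open import Relation.Nullary.Decidable using (Dec; does)

-- 𝔽₂ is Bool with addition _xor_ and multiplication _∧_, as in
-- Data.Bool.Properties.xor-∧-commutativeRing.

𝔽₂^ : ℕ → Set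
𝔽₂^ n = Vec Bool n

infixl 6 _⊕_
_⊕_ : ∀ {n} → 𝔽₂^ n → 𝔽₂^ n → 𝔽₂^ n
_⊕_ = zipWith _xor_

𝟎 : ∀ {n} → 𝔽₂^ n
𝟎 = replicate _ false

infixr 7 _·_
_·_ : ∀ {n} → Bool → 𝔽₂^ n → 𝔽₂^ n
c · v = Vec.map (c ∧_) v

infix 4 _≟_
_≟_ : ∀ {n} (u v : 𝔽₂^ n) → Dec (u ≡ v)
_≟_ = ≡-dec Bool._≟_

-- Every vector occurs exactly once.
vectors : ∀ n → List (𝔽₂^ n)
vectors zero    = Vec.[] ∷ []
vectors (suc n) = map (false Vec.∷_) (vectors n) ++ map (true Vec.∷_) (vectors n)

-- Subsets of the finite set 𝔽₂^ n are given by their characteristic functions.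
Subset : ℕ → Set
Subset n = 𝔽₂^ n → Bool

infix 4 _∈_ _⊆_
_∈_ : ∀ {n} → 𝔽₂^ n → Subset n → Set
x ∈ S = T (S x)

_⊆_ : ∀ {n} → Subset n → Subset n → Set
S ⊆ S′ = ∀ x → x ∈ S → x ∈ S′

Nonempty : ∀ {n} → Subset n → Set
Nonempty S = ∃[ x ] x ∈ S

∣_∣ : ∀ {n} → Subset n → ℕ
∣_∣ {n} S = length (filterᵇ S (vectors n))

infixl 6 _△_ _+ˢ_
_△_ : ∀ {n} → Subset n → Subset n → Subset n
(S △ S′) x = S x xor S′ x

-- x ∈ S +ˢ S′ iff x ≡ s ⊕ s′ for some s ∈ S and s′ ∈ S′.
_+ˢ_ : ∀ {n} → Subset n → Subset n → Subset n
_+ˢ_ {n} S S′ x =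
  any (λ s → any (λ s′ → S s ∧ S′ s′ ∧ does (x ≟ s ⊕ s′)) (vectors n)) (vectors n)

record IsSubspace {n} (V : Subset n) : Set where
  field
    𝟎-mem    : 𝟎 ∈ V
    ⊕-closed : ∀ {u v} → u ∈ V → v ∈ V → u ⊕ v ∈ V
    ·-closed : ∀ c {v} → v ∈ V → c · v ∈ V

IsMinimum : (ℕ → Set) → ℕ → Set
IsMinimum P m = P m × (∀ k → P k → m ≤ k)

-- 𝒩 V ⟨ S ⟩≐ k says that 𝒩_V(S) = k, where 𝒩_V(S) = min { |C| : S ⊆ C + V }.
-- The minimum exists for every subspace V, since S ⊆ S + V.
infix 4 𝒩_⟨_⟩≐_
𝒩_⟨_⟩≐_ : ∀ {n} → Subset n → Subset n → ℕ → Set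
𝒩_⟨_⟩≐_ {n} V S = IsMinimum (λ k → ∃[ C ] (S ⊆ C +ˢ V × ∣ C ∣ ≡ k))

fromℕ : ℕ → ℚ
fromℕ k = + k / 1

2^-_ : ℕ → ℚ
2^- t = _/_ (+ 1) (2 ^ t) {{m^n≢0 2 t}}

{-# OPTIONS --safe #-}
-- Take H₀ = 𝔽₂ᵗ × 0, H₁ = 0 × 𝔽₂ᵗ and B = {0}.  Each Hᵢ contains a complement
-- of Hᵢ ∩ V, of dimension dᵢ say, and 𝒩_V(Hᵢ) = 2^dᵢ.  The two complements and V
-- together span 𝔽₂²ᵗ, so |V| ≤ 2ᵗ forces t ≤ d₀ + d₁, hence ⌈t/2⌉ ≤ max(d₀, d₁).
-- (That 𝒩_V(Hᵢ) is a power of 2 matters: 𝒩_V(H₀) 𝒩_V(H₁) ≥ 2ᵗ alone does not give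
-- the bound for odd t.)  Equality holds for V = {((a , 0) , (b , 0))} with a and b of
-- length ⌊t/2⌋.
module Submission where

open import Defs
open import Algebra.Bundles using (AbelianGroup)
import Algebra.Properties.AbelianGroup as AbelianGroupProperties
import Algebra.Properties.CommutativeSemigroup as CommutativeSemigroupProperties
open import Data.Bool.Base using (true; false; _xor_; T)
open import Data.Bool.ListAction using (any)
import Data.Bool.Properties as Bool
open import Data.Fin.Base using (Fin; zero; suc)
open import Data.Fin.Patterns using (0F; 1F)
open import Data.Fin.Properties using (injective⇒≤)
open import Data.Integer.Base as ℤ using (+_)
import Data.Integer.Properties as ℤ
open import Data.List.Base as List using (List; []; _∷_; map; length; filterᵇ; lookup; cartesianProductWith)
open import Data.List.Membership.Propositional using (lose) renaming (_∈_ to _∈ˡ_)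
open import Data.List.Membership.Propositional.Properties
  using (∈-map⁺; ∈-map⁻; ∈-++⁺ˡ; ∈-++⁺ʳ; ∈-filter⁺; ∈-filter⁻; ∈-lookup; ∈-cartesianProductWith⁺)
open import Data.List.Membership.Setoid.Properties using (index-injective)
open import Data.List.Properties using (length-map; length-++)
import Data.List.Relation.Unary.All as All
open import Data.List.Relation.Unary.AllPairs using ([]; _∷_)
open import Data.List.Relation.Unary.Any using (here; any?; satisfied; index)
open import Data.List.Relation.Unary.Any.Properties using (any⁺; any⁻)
open import Data.List.Relation.Unary.Unique.Propositional using (Unique)
open import Data.List.Relation.Unary.Unique.Propositional.Properties using (map⁺; ++⁺; filter⁺)
open import Data.Nat.Base as ℕ using (ℕ; _+_; _≤_; _≥_; _^_; _⊔_; ⌈_/2⌉; ⌊_/2⌋; NonZero)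
open import Data.Nat.Properties hiding (_≟_)
open import Data.Product using (Σ-syntax; _×_; ∃-syntax; _,_; proj₁; proj₂)
open import Data.Rational.Base using (1ℚ; -_; _-_; _*_; _/_; toℚᵘ)
import Data.Rational.Properties as ℚ
open import Data.Rational.Unnormalised.Base as ℚᵘ using (mkℚᵘ; *≡*)
import Data.Rational.Unnormalised.Properties as ℚᵘ
open import Data.Vec.Base using ([]; _∷_; _++_; take; drop)
open import Data.Vec.Properties
  using (zipWith-assoc; zipWith-comm; zipWith-identityˡ; zipWith-identityʳ; zipWith-++;
         take-zipWith; drop-zipWith; take++drop≡id; ++-injective; ++-injectiveˡ; ++-injectiveʳ;
         ∷-injectiveʳ; map-id; map-const)
open import Function.Base using (_∘_; id)
open import Function.Bundles using (module Equivalence)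
open import Function.Definitions using (Injective)
open import Level using (0ℓ)
open import Relation.Binary.PropositionalEquality
open import Relation.Nullary.Decidable using (Dec; does; yes; no; T?)
open import Relation.Nullary.Negation using (contradiction)

private variable
  A A′ A″ : Set
  k l m n : ℕ

-- The additive group of 𝔽₂ⁿ.

⊕-abelianGroup : ℕ → AbelianGroup 0ℓ 0ℓ
⊕-abelianGroup n = record
  { Carrier = 𝔽₂^ n
  ; _≈_ = _≡_
  ; _∙_ = _⊕_
  ; ε = 𝟎
  -- In characteristic 2 every vector is its own inverse, so the general group laws about `x ∙ y ⁻¹`
  -- become laws about `x ⊕ y`.
  ; _⁻¹ = id
  ; isAbelianGroup = record
    { isGroup = record
      { isMonoid = record
        { isSemigroup = record
          { isMagma = isMagma _⊕_
          ; assoc = zipWith-assoc Bool.xor-assoc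
          }
        ; identity = zipWith-identityˡ Bool.xor-identityˡ , zipWith-identityʳ Bool.xor-identityʳ
        }
      ; inverse = ⊕-self , ⊕-self
      ; ⁻¹-cong = id
      }
    ; comm = zipWith-comm Bool.xor-comm
    }
  }
  where
  ⊕-self : (x : 𝔽₂^ m) → x ⊕ x ≡ 𝟎
  ⊕-self []      = refl
  ⊕-self (b ∷ x) = cong₂ _∷_ (Bool.xor-same b) (⊕-self x)

module _ {n : ℕ} where
  open AbelianGroup (⊕-abelianGroup n) public
    using () renaming (identityˡ to ⊕-identityˡ; identityʳ to ⊕-identityʳ; inverseʳ to ⊕-self; comm to ⊕-comm)
  open AbelianGroupProperties (⊕-abelianGroup n) public
    using () renaming (x∙y⁻¹≈ε⇒x≈y to x⊕y≡𝟎⇒x≡y; //-rightDividesʳ to x⊕y⊕y≡x)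
  open CommutativeSemigroupProperties (AbelianGroup.commutativeSemigroup (⊕-abelianGroup n)) public
    using () renaming (interchange to ⊕-interchange)

-- Counting with duplicate-free lists.

lookup-injective : {xs : List A} → Unique xs → Injective _≡_ _≡_ (lookup xs)
lookup-injective (_ ∷ _)      {zero}  {zero}  _  = refl
lookup-injective (x∉xs ∷ _)   {zero}  {suc j} eq = contradiction eq (All.lookup x∉xs (∈-lookup j))
lookup-injective (x∉xs ∷ _)   {suc i} {zero}  eq = contradiction (sym eq) (All.lookup x∉xs (∈-lookup i))
lookup-injective (_ ∷ xs!)    {suc i} {suc j} eq = cong suc (lookup-injective xs! eq)

-- Pigeonhole principle: send each position of `xs` to the position in `ys` where its entry is
-- found. Positions with the same image carry equal entries, so they coincide by uniqueness.
unique-⊆⇒length-≤ : {xs ys : List A} → Unique xs → (∀ {x} → x ∈ˡ xs → x ∈ˡ ys) → length xs ≤ length ys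
unique-⊆⇒length-≤ {xs = xs} xs! xs⊆ys = injective⇒≤ {f = λ i → index (xs⊆ys (∈-lookup {xs = xs} i))}
  (λ {i} {j} eq → lookup-injective xs!
    (index-injective (setoid _) (xs⊆ys (∈-lookup i)) (xs⊆ys (∈-lookup j)) eq))

length-cartesianProductWith : (f : A → A′ → A″) (xs : List A) (ys : List A′) →
  length (cartesianProductWith f xs ys) ≡ length xs ℕ.* length ys
length-cartesianProductWith f []       ys = refl
length-cartesianProductWith f (x ∷ xs) ys = begin
  length (map (f x) ys List.++ cartesianProductWith f xs ys)
    ≡⟨ length-++ (map (f x) ys) ⟩
  length (map (f x) ys) + length (cartesianProductWith f xs ys)
    ≡⟨ cong₂ _+_ (length-map (f x) ys) (length-cartesianProductWith f xs ys) ⟩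
  length ys + length xs ℕ.* length ys ∎
  where open ≡-Reasoning

∈-vectors : (x : 𝔽₂^ n) → x ∈ˡ vectors n
∈-vectors []          = here refl
∈-vectors (false ∷ x) = ∈-++⁺ˡ (∈-map⁺ (false ∷_) (∈-vectors x))
∈-vectors {ℕ.suc n} (true ∷ x) = ∈-++⁺ʳ (map (false ∷_) (vectors n)) (∈-map⁺ (true ∷_) (∈-vectors x))

vectors-unique : ∀ n → Unique (vectors n)
vectors-unique ℕ.zero    = All.[] ∷ []
vectors-unique (ℕ.suc n) =
  ++⁺ (map⁺ ∷-injectiveʳ (vectors-unique n)) (map⁺ ∷-injectiveʳ (vectors-unique n)) disjoint
  where
  disjoint : ∀ {x} → x ∈ˡ map (false ∷_) (vectors n) × x ∈ˡ map (true ∷_) (vectors n) → _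
  disjoint (p , q) with ∈-map⁻ (false ∷_) p | ∈-map⁻ (true ∷_) q
  ... | _ , _ , refl | _ , _ , ()

length-vectors : ∀ n → length (vectors n) ≡ 2 ^ n
length-vectors ℕ.zero    = refl
length-vectors (ℕ.suc n) = begin
  length (map (false ∷_) (vectors n) List.++ map (true ∷_) (vectors n))
    ≡⟨ length-++ (map (false ∷_) (vectors n)) ⟩
  length (map (false ∷_) (vectors n)) + length (map (true ∷_) (vectors n))
    ≡⟨ cong₂ _+_ (trans (length-map _ (vectors n)) (length-vectors n))
                 (trans (length-map _ (vectors n)) (trans (length-vectors n) (sym (+-identityʳ _)))) ⟩
  2 ^ ℕ.suc n ∎
  where open ≡-Reasoning

elements : Subset n → List (𝔽₂^ n)
elements {n} S = filterᵇ S (vectors n)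

∈-elements : (S : Subset n) {x : 𝔽₂^ n} → x ∈ S → x ∈ˡ elements S
∈-elements S = ∈-filter⁺ (T? ∘ S) (∈-vectors _)

∣∣≤length : (S : Subset n) (xs : List (𝔽₂^ n)) → (∀ {x} → x ∈ S → x ∈ˡ xs) → ∣ S ∣ ≤ length xs
∣∣≤length {n} S xs S⊆xs = unique-⊆⇒length-≤ (filter⁺ (T? ∘ S) (vectors-unique n))
  (S⊆xs ∘ proj₂ ∘ ∈-filter⁻ (T? ∘ S) {xs = vectors n})

injective⇒2^≤∣∣ : (S : Subset n) (f : 𝔽₂^ k → 𝔽₂^ n) → Injective _≡_ _≡_ f → (∀ x → f x ∈ S) → 2 ^ k ≤ ∣ S ∣
injective⇒2^≤∣∣ {k = k} S f f-inj f∈S = begin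
  2 ^ k                       ≡⟨ trans (length-map f (vectors k)) (length-vectors k) ⟨
  length (map f (vectors k))  ≤⟨ unique-⊆⇒length-≤ (map⁺ f-inj (vectors-unique k)) image⊆S ⟩
  ∣ S ∣                       ∎
  where
  open ≤-Reasoning
  image⊆S : ∀ {y} → y ∈ˡ map f (vectors k) → y ∈ˡ elements S
  image⊆S p with ∈-map⁻ f p
  ... | x , _ , refl = ∈-elements S (f∈S x)

∣∣-mono : {S S′ : Subset n} → S ⊆ S′ → ∣ S ∣ ≤ ∣ S′ ∣
∣∣-mono {S = S} {S′} S⊆S′ = ∣∣≤length S (elements S′) (∈-elements S′ ∘ S⊆S′ _)

-- For nested sets the symmetric difference is the part of `S` outside `S′`. The additive form
-- avoids truncated subtraction.
∣△∣ : (S S′ : Subset n) → S′ ⊆ S → ∣ S′ ∣ + ∣ S △ S′ ∣ ≡ ∣ S ∣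
∣△∣ {n} S S′ S′⊆S = go (vectors n)
  where
  go : ∀ xs → length (filterᵇ S′ xs) + length (filterᵇ (S △ S′) xs) ≡ length (filterᵇ S xs)
  go []       = refl
  go (x ∷ xs) with S x | S′ x | S′⊆S x
  ... | true  | true  | _ = cong ℕ.suc (go xs)
  ... | true  | false | _ = trans (+-suc _ _) (cong ℕ.suc (go xs))
  ... | false | true  | h = contradiction (h _) id
  ... | false | false | _ = go xs

-- Sumsets.

T-does⁺ : (a? : Dec A) → A → T (does a?)
T-does⁺ (yes _) _ = _
T-does⁺ (no ¬a) a = ¬a a

T-does⁻ : (a? : Dec A) → T (does a?) → A
T-does⁻ (yes a) _ = a

any-vectors⁺ : (p : Subset n) → Nonempty p → T (any p (vectors n))
any-vectors⁺ p (x , px) = any⁺ p (lose (∈-vectors x) px)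

any-vectors⁻ : (p : Subset n) → T (any p (vectors n)) → Nonempty p
any-vectors⁻ {n} p = satisfied ∘ any⁻ p (vectors n)

∈-+ˢ⁺ : (S S′ : Subset n) (s s′ : 𝔽₂^ n) → s ∈ S → s′ ∈ S′ → s ⊕ s′ ∈ S +ˢ S′
∈-+ˢ⁺ S S′ s s′ s∈S s′∈S′ =
  any-vectors⁺ _ (s , any-vectors⁺ _ (s′ ,
    Equivalence.from Bool.T-∧ (s∈S , Equivalence.from Bool.T-∧ (s′∈S′ , T-does⁺ (s ⊕ s′ ≟ s ⊕ s′) refl))))

∈-+ˢ⁻ : (S S′ : Subset n) (x : 𝔽₂^ n) → x ∈ S +ˢ S′ → ∃[ s ] ∃[ s′ ] (s ∈ S × s′ ∈ S′ × x ≡ s ⊕ s′)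
∈-+ˢ⁻ S S′ x p
  with s , q ← any-vectors⁻ _ p
  with s′ , r ← any-vectors⁻ _ q
  with s∈S , r′ ← Equivalence.to (Bool.T-∧ {S s}) r
  with s′∈S′ , e ← Equivalence.to (Bool.T-∧ {S′ s′}) r′
  = s , s′ , s∈S , s′∈S′ , T-does⁻ (x ≟ s ⊕ s′) e

∣V+V∣≡∣V∣ : {V : Subset n} → IsSubspace V → ∣ V +ˢ V ∣ ≡ ∣ V ∣
∣V+V∣≡∣V∣ {V = V} V-sub = ≤-antisym (∣∣-mono V+V⊆V) (∣∣-mono V⊆V+V)
  where
  open IsSubspace V-sub
  V+V⊆V : V +ˢ V ⊆ V
  V+V⊆V x p with ∈-+ˢ⁻ V V x p
  ... | _ , _ , v∈V , v′∈V , refl = ⊕-closed v∈V v′∈V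
  V⊆V+V : V ⊆ V +ˢ V
  V⊆V+V x x∈V = subst (_∈ V +ˢ V) (⊕-identityʳ x) (∈-+ˢ⁺ V V x 𝟎 x∈V 𝟎-mem)

-- Ranges of additive maps.

range : (𝔽₂^ k → 𝔽₂^ n) → Subset n
range {k} f x = any (λ y → does (x ≟ f y)) (vectors k)

∈-range⁺ : (f : 𝔽₂^ k → 𝔽₂^ n) (y : 𝔽₂^ k) → f y ∈ range f
∈-range⁺ f y = any-vectors⁺ _ (y , T-does⁺ (f y ≟ f y) refl)

∈-range⁻ : (f : 𝔽₂^ k → 𝔽₂^ n) (x : 𝔽₂^ n) → x ∈ range f → ∃[ y ] x ≡ f y
∈-range⁻ f x p with y , q ← any-vectors⁻ _ p = y , T-does⁻ (x ≟ f y) q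

∣range∣≤2^ : (f : 𝔽₂^ k → 𝔽₂^ n) → ∣ range f ∣ ≤ 2 ^ k
∣range∣≤2^ {k} f = begin
  ∣ range f ∣                 ≤⟨ ∣∣≤length (range f) (map f (vectors k)) ∈-image ⟩
  length (map f (vectors k))  ≡⟨ trans (length-map f (vectors k)) (length-vectors k) ⟩
  2 ^ k                       ∎
  where
  open ≤-Reasoning
  ∈-image : ∀ {x} → x ∈ range f → x ∈ˡ map f (vectors k)
  ∈-image {x} p with ∈-range⁻ f x p
  ... | y , refl = ∈-map⁺ f (∈-vectors y)

∣range∣≡2^ : (f : 𝔽₂^ k → 𝔽₂^ n) → Injective _≡_ _≡_ f → ∣ range f ∣ ≡ 2 ^ k
∣range∣≡2^ f f-inj = ≤-antisym (∣range∣≤2^ f) (injective⇒2^≤∣∣ (range f) f f-inj (∈-range⁺ f))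

-- This is already linearity, because the only scalars are 0 and 1.
Additive : (𝔽₂^ k → 𝔽₂^ n) → Set
Additive f = ∀ x y → f (x ⊕ y) ≡ f x ⊕ f y

additive-𝟎 : {f : 𝔽₂^ k → 𝔽₂^ n} → Additive f → f 𝟎 ≡ 𝟎
additive-𝟎 {f = f} f-add = begin
  f 𝟎            ≡⟨ cong f (⊕-self 𝟎) ⟨
  f (𝟎 ⊕ 𝟎)      ≡⟨ f-add 𝟎 𝟎 ⟩
  f 𝟎 ⊕ f 𝟎      ≡⟨ ⊕-self (f 𝟎) ⟩
  𝟎              ∎
  where open ≡-Reasoning

range-isSubspace : {f : 𝔽₂^ k → 𝔽₂^ n} → Additive f → IsSubspace (range f)
range-isSubspace {f = f} f-add = record
  { 𝟎-mem = 𝟎∈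
  ; ⊕-closed = λ {u} {v} p q → ⊕∈ (∈-range⁻ f u p) (∈-range⁻ f v q)
  ; ·-closed = ·∈
  }
  where
  𝟎∈ : 𝟎 ∈ range f
  𝟎∈ = subst (_∈ range f) (additive-𝟎 f-add) (∈-range⁺ f 𝟎)
  ⊕∈ : ∀ {u v} → ∃[ x ] u ≡ f x → ∃[ y ] v ≡ f y → u ⊕ v ∈ range f
  ⊕∈ (x , refl) (y , refl) = subst (_∈ range f) (f-add x y) (∈-range⁺ f (x ⊕ y))
  ·∈ : ∀ c {v} → v ∈ range f → c · v ∈ range f
  ·∈ true  {v} v∈ = subst (_∈ range f) (sym (map-id v)) v∈
  ·∈ false {v} v∈ = subst (_∈ range f) (sym (map-const v false)) 𝟎∈

-- Complements modulo a subspace.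

-- The image of embed is a complement of V ∩ range f in range f.
record Complement (V : Subset n) (f : 𝔽₂^ k → 𝔽₂^ n) : Set where
  field
    dim         : ℕ
    embed       : 𝔽₂^ dim → 𝔽₂^ n
    additive    : Additive embed
    embed∈range : ∀ y → ∃[ x ] embed y ≡ f x
    independent : ∀ y → embed y ∈ V → y ≡ 𝟎
    spanning    : ∀ x → ∃[ y ] f x ⊕ embed y ∈ V

-- The images under f of the standard basis are added one at a time, skipping
-- those that already lie in the span modulo V of the ones retained.
complement : {V : Subset n} → IsSubspace V → (f : 𝔽₂^ k → 𝔽₂^ n) → Additive f → Complement V f
complement {k = ℕ.zero} {V} V-sub f f-add = record
  { dim = 0
  ; embed = f
  ; additive = f-add
  ; embed∈range = λ y → y , refl
  ; independent = λ { [] _ → refl }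
  ; spanning = λ x → x , subst (_∈ V) (sym (⊕-self (f x))) (IsSubspace.𝟎-mem V-sub)
  }
complement {n} {ℕ.suc k} {V} V-sub f f-add = extend (any? (λ y → T? (V (f (true ∷ 𝟎) ⊕ embed y))) (vectors dim))
  where
  open IsSubspace V-sub
  -- Induction on the domain: a complement is already available for the restriction of `f` to
  -- vectors with first coordinate 0.
  open Complement (complement V-sub (λ x → f (false ∷ x)) (λ x y → f-add (false ∷ x) (false ∷ y)))

  f-∷ : ∀ b x → f (b ∷ x) ≡ f (b ∷ 𝟎) ⊕ f (false ∷ x)
  f-∷ b x = begin
    f (b ∷ x)                     ≡⟨ cong f (cong₂ _∷_ (Bool.xor-identityʳ b) (⊕-identityˡ x)) ⟨
    f ((b ∷ 𝟎) ⊕ (false ∷ x))     ≡⟨ f-add (b ∷ 𝟎) (false ∷ x) ⟩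
    f (b ∷ 𝟎) ⊕ f (false ∷ x)     ∎
    where open ≡-Reasoning

  extend : Dec _ → Complement V f
  extend (yes p) with y₀ , e⊕gy₀∈V ← satisfied p = record
    { dim = dim
    ; embed = embed
    ; additive = additive
    ; embed∈range = λ y → let x , eq = embed∈range y in false ∷ x , eq
    ; independent = independent
    ; spanning = spanning′
    }
    where
    spanning′ : ∀ x → ∃[ y ] f x ⊕ embed y ∈ V
    spanning′ (false ∷ x) = spanning x
    -- Modulo `V`, `embed y₀` represents `f (true ∷ 𝟎)` and `embed y` represents `f (false ∷ x)`, so
    -- the sum represents `f (true ∷ x)`.
    spanning′ (true ∷ x) with y , q ← spanning x =
      y₀ ⊕ y , subst (_∈ V) eq (⊕-closed e⊕gy₀∈V q)
      where
      eq = begin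
        (f (true ∷ 𝟎) ⊕ embed y₀) ⊕ (f (false ∷ x) ⊕ embed y)  ≡⟨ ⊕-interchange _ _ _ _ ⟩
        (f (true ∷ 𝟎) ⊕ f (false ∷ x)) ⊕ (embed y₀ ⊕ embed y)  ≡⟨ cong₂ _⊕_ (f-∷ true x) (additive y₀ y) ⟨
        f (true ∷ x) ⊕ embed (y₀ ⊕ y)                          ∎
        where open ≡-Reasoning
  extend (no ¬p) = record
    { dim = ℕ.suc dim
    ; embed = embed′
    ; additive = additive′
    ; embed∈range = embed∈range′
    ; independent = independent′
    ; spanning = spanning′
    }
    where
    embed′ : 𝔽₂^ (ℕ.suc dim) → 𝔽₂^ n
    embed′ (b ∷ y) = f (b ∷ 𝟎) ⊕ embed y

    additive′ : Additive embed′
    additive′ (b ∷ x) (c ∷ y) = begin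
      f ((b xor c) ∷ 𝟎) ⊕ embed (x ⊕ y)                ≡⟨ cong₂ _⊕_ (cong (λ z → f ((b xor c) ∷ z)) (sym (⊕-self 𝟎))) (additive x y) ⟩
      f ((b ∷ 𝟎) ⊕ (c ∷ 𝟎)) ⊕ (embed x ⊕ embed y)      ≡⟨ cong (_⊕ (embed x ⊕ embed y)) (f-add (b ∷ 𝟎) (c ∷ 𝟎)) ⟩
      (f (b ∷ 𝟎) ⊕ f (c ∷ 𝟎)) ⊕ (embed x ⊕ embed y)    ≡⟨ ⊕-interchange _ _ _ _ ⟩
      (f (b ∷ 𝟎) ⊕ embed x) ⊕ (f (c ∷ 𝟎) ⊕ embed y)    ∎
      where open ≡-Reasoning

    embed∈range′ : ∀ y → ∃[ x ] embed′ y ≡ f x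
    embed∈range′ (b ∷ y) with x , eq ← embed∈range y =
      b ∷ x , trans (cong (f (b ∷ 𝟎) ⊕_) eq) (sym (f-∷ b x))

    independent′ : ∀ y → embed′ y ∈ V → y ≡ 𝟎
    -- A vector of `V` that involves the new generator would be a hit of the search that came out
    -- empty.
    independent′ (true ∷ y)  p = contradiction (lose (∈-vectors y) p) ¬p
    independent′ (false ∷ y) p = cong (false ∷_) (independent y
      (subst (_∈ V) (trans (cong (_⊕ embed y) (additive-𝟎 f-add)) (⊕-identityˡ (embed y))) p))

    spanning′ : ∀ x → ∃[ y ] f x ⊕ embed′ y ∈ V
    -- The new generator takes care of the first coordinate: `f (b ∷ 𝟎)` occurs in both summands and
    -- cancels.
    spanning′ (b ∷ x) with y , q ← spanning x = b ∷ y , subst (_∈ V) eq q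
      where
      eq = begin
        f (false ∷ x) ⊕ embed y                                ≡⟨ ⊕-identityˡ _ ⟨
        𝟎 ⊕ (f (false ∷ x) ⊕ embed y)                          ≡⟨ cong (_⊕ (f (false ∷ x) ⊕ embed y)) (⊕-self (f (b ∷ 𝟎))) ⟨
        (f (b ∷ 𝟎) ⊕ f (b ∷ 𝟎)) ⊕ (f (false ∷ x) ⊕ embed y)    ≡⟨ ⊕-interchange _ _ _ _ ⟩
        (f (b ∷ 𝟎) ⊕ f (false ∷ x)) ⊕ (f (b ∷ 𝟎) ⊕ embed y)    ≡⟨ cong (_⊕ embed′ (b ∷ y)) (f-∷ b x) ⟨
        f (b ∷ x) ⊕ embed′ (b ∷ y)                             ∎
        where open ≡-Reasoning

-- Covering numbers of ranges.

module _ {V : Subset n} (V-sub : IsSubspace V) {f : 𝔽₂^ k → 𝔽₂^ n} (G : Complement V f) where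
  open IsSubspace V-sub
  open Complement G

  -- Choose for each embedded vector a centre of a coset containing it. Two vectors with the same
  -- centre differ by an element of `V`, so independence makes them equal; the choice is injective.
  cover⇒2^dim≤ : {C : Subset n} → range f ⊆ C +ˢ V → 2 ^ dim ≤ ∣ C ∣
  cover⇒2^dim≤ {C} cover = injective⇒2^≤∣∣ C (proj₁ ∘ decompose) 
    (λ {x} {y} → common-centre (decompose x) (decompose y)) (proj₁ ∘ proj₂ ∘ proj₂ ∘ decompose)
    where
    Decomposition : 𝔽₂^ dim → Set
    Decomposition y = ∃[ c ] ∃[ v ] (c ∈ C × v ∈ V × embed y ≡ c ⊕ v)

    decompose : ∀ y → Decomposition y
    decompose y = ∈-+ˢ⁻ C V (embed y) (cover (embed y)
      (let x , eq = embed∈range y in subst (_∈ range f) (sym eq) (∈-range⁺ f x)))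

    common-centre : ∀ {x y} (p : Decomposition x) (q : Decomposition y) → proj₁ p ≡ proj₁ q → x ≡ y
    common-centre {x} {y} (c , v , _ , v∈V , x≡) (_ , v′ , _ , v′∈V , y≡) refl =
      x⊕y≡𝟎⇒x≡y x y (independent (x ⊕ y) (subst (_∈ V) (sym embed-x⊕y) (⊕-closed v∈V v′∈V)))
      where
      embed-x⊕y : embed (x ⊕ y) ≡ v ⊕ v′
      embed-x⊕y = begin
        embed (x ⊕ y)        ≡⟨ additive x y ⟩
        embed x ⊕ embed y    ≡⟨ cong₂ _⊕_ x≡ y≡ ⟩
        (c ⊕ v) ⊕ (c ⊕ v′)   ≡⟨ ⊕-interchange c v c v′ ⟩
        (c ⊕ c) ⊕ (v ⊕ v′)   ≡⟨ cong (_⊕ (v ⊕ v′)) (⊕-self c) ⟩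
        𝟎 ⊕ (v ⊕ v′)         ≡⟨ ⊕-identityˡ _ ⟩
        v ⊕ v′               ∎
        where open ≡-Reasoning

  -- The complement itself serves as the set of centres: `f y` is `embed z` plus the element
  -- `f y ⊕ embed z` of `V`.
  complement-covers : range f ⊆ range embed +ˢ V
  complement-covers x x∈ with ∈-range⁻ f x x∈
  ... | y , refl with z , q ← spanning y = subst (_∈ range embed +ˢ V)
    (trans (⊕-comm _ _) (x⊕y⊕y≡x (embed z) (f y)))
    (∈-+ˢ⁺ (range embed) V (embed z) (f y ⊕ embed z) (∈-range⁺ embed z) q)

  𝒩-range : 𝒩 V ⟨ range f ⟩≐ 2 ^ dim
  𝒩-range =
      (range embed , complement-covers , ≤-antisym (∣range∣≤2^ embed) (cover⇒2^dim≤ complement-covers))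
    , λ { _ (C , cover , refl) → cover⇒2^dim≤ cover }

  -- The form used in the lower bound, where `a` is any number certified as the covering number: its
  -- witnessing cover already has the required size.
  2^dim≤𝒩 : ∀ {a} → 𝒩 V ⟨ range f ⟩≐ a → 2 ^ dim ≤ a
  2^dim≤𝒩 ((C , cover , refl) , _) = cover⇒2^dim≤ cover

-- Counting and rounding for the lower bound.

2^-cancel-≤ : 2 ^ m ≤ 2 ^ n → m ≤ n
2^-cancel-≤ le = ≮⇒≥ (λ n<m → <⇒≱ (^-monoʳ-< 2 ≤-refl n<m) le)

-- Both summands are at most `m ⊔ n`, so `k` is at most its double. The ceiling appears here because
-- the exponents are integers.
⌈/2⌉≤⊔ : k ≤ m + n → ⌈ k /2⌉ ≤ m ⊔ n
⌈/2⌉≤⊔ {k} {m} {n} k≤m+n = begin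
  ⌈ k /2⌉                      ≤⟨ ⌈n/2⌉-mono (≤-trans k≤m+n (+-mono-≤ (m≤m⊔n m n) (m≤n⊔m m n))) ⟩
  ⌈ (m ⊔ n) + (m ⊔ n) /2⌉      ≡⟨ n≡⌈n+n/2⌉ (m ⊔ n) ⟨
  m ⊔ n                        ∎
  where open ≤-Reasoning

-- Each vector is a sum of a vector from each range, and each of these is an embedded vector plus an
-- element of `V`. Hence the two complements and `V` together reach all of 𝔽₂ⁿ, and the number of
-- triples bounds its size.
complements-capacity : {V : Subset n} {f : 𝔽₂^ k → 𝔽₂^ n} {g : 𝔽₂^ l → 𝔽₂^ n} →
  (F : Complement V f) (G : Complement V g) →
  (∀ x → ∃[ y ] ∃[ z ] x ≡ f y ⊕ g z) → IsSubspace V →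
  2 ^ n ≤ 2 ^ (Complement.dim F + Complement.dim G) ℕ.* ∣ V ∣
complements-capacity {n} {V = V} {f} {g} F G sum V-sub = begin
  2 ^ n                                       ≡⟨ length-vectors n ⟨
  length (vectors n)                          ≤⟨ unique-⊆⇒length-≤ (vectors-unique n) (λ {x} _ → ∈-sums x) ⟩
  length (cartesianProductWith _⊕_ cosets (elements V))
                                              ≡⟨ length-cartesianProductWith _⊕_ cosets (elements V) ⟩
  length cosets ℕ.* ∣ V ∣                     ≡⟨ cong (ℕ._* ∣ V ∣) length-cosets ⟩
  2 ^ (F.dim + G.dim) ℕ.* ∣ V ∣               ∎
  where
  module F = Complement F
  module G = Complement G
  open ≤-Reasoning
  cosets : List (𝔽₂^ n)
  cosets = cartesianProductWith (λ y z → F.embed y ⊕ G.embed z) (vectors F.dim) (vectors G.dim)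
  length-cosets : length cosets ≡ 2 ^ (F.dim + G.dim)
  length-cosets = begin-equality
    length cosets                                         ≡⟨ length-cartesianProductWith _ (vectors F.dim) (vectors G.dim) ⟩
    length (vectors F.dim) ℕ.* length (vectors G.dim)     ≡⟨ cong₂ ℕ._*_ (length-vectors F.dim) (length-vectors G.dim) ⟩
    2 ^ F.dim ℕ.* 2 ^ G.dim                               ≡⟨ ^-distribˡ-+-* 2 F.dim G.dim ⟨
    2 ^ (F.dim + G.dim)                                   ∎
  ∈-sums : ∀ x → x ∈ˡ cartesianProductWith _⊕_ cosets (elements V)
  ∈-sums x with sum x
  ... | y , z , refl with u , p ← F.spanning y | w , q ← G.spanning z =
    subst (_∈ˡ cartesianProductWith _⊕_ cosets (elements V)) eq
      (∈-cartesianProductWith⁺ _⊕_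
        (∈-cartesianProductWith⁺ _ (∈-vectors u) (∈-vectors w))
        (∈-elements V (IsSubspace.⊕-closed V-sub p q)))
    where
    eq : (F.embed u ⊕ G.embed w) ⊕ ((f y ⊕ F.embed u) ⊕ (g z ⊕ G.embed w)) ≡ f y ⊕ g z
    -- The representative `F.embed u ⊕ G.embed w` occurs twice and cancels.
    eq = trans (cong ((F.embed u ⊕ G.embed w) ⊕_) (⊕-interchange _ _ _ _))
      (trans (⊕-comm _ _) (x⊕y⊕y≡x (F.embed u ⊕ G.embed w) (f y ⊕ g z)))

-- The distance identity in rational arithmetic.

fromℕ-[1-1/N]*N : ∀ m N .{{_ : NonZero N}} → ℕ.suc m ≡ N → fromℕ m ≡ (1ℚ - + 1 / N) * fromℕ N
-- Passing to unnormalised rationals avoids gcd reductions and leaves an identity of integers. Since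
-- `mkℚᵘ` stores the denominator minus one, `mkℚᵘ (+ 1) m` is 1/N.
fromℕ-[1-1/N]*N m N refl = ℚ.toℚᵘ-injective (begin
  toℚᵘ (fromℕ m)                                           ≈⟨ ℚ.toℚᵘ-fromℚᵘ (mkℚᵘ (+ m) 0) ⟩
  mkℚᵘ (+ m) 0                                             ≈⟨ *≡* cross-multiplied ⟩
  (ℚᵘ.1ℚᵘ ℚᵘ.- mkℚᵘ (+ 1) m) ℚᵘ.* mkℚᵘ (+ N) 0             ≈⟨ ℚᵘ.*-cong
    (ℚᵘ.+-congʳ ℚᵘ.1ℚᵘ (ℚᵘ.-‿cong (ℚ.toℚᵘ-fromℚᵘ (mkℚᵘ (+ 1) m)))) (ℚ.toℚᵘ-fromℚᵘ (mkℚᵘ (+ N) 0)) ⟨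
  (ℚᵘ.1ℚᵘ ℚᵘ.- toℚᵘ (+ 1 / N)) ℚᵘ.* toℚᵘ (fromℕ N)         ≈⟨ ℚᵘ.*-congʳ
    (ℚᵘ.+-congʳ ℚᵘ.1ℚᵘ (ℚ.toℚᵘ-homo‿- (+ 1 / N))) ⟨
  (ℚᵘ.1ℚᵘ ℚᵘ.+ toℚᵘ (- (+ 1 / N))) ℚᵘ.* toℚᵘ (fromℕ N)     ≈⟨ ℚᵘ.*-congʳ (ℚ.toℚᵘ-homo-+ 1ℚ (- (+ 1 / N))) ⟨
  toℚᵘ (1ℚ - + 1 / N) ℚᵘ.* toℚᵘ (fromℕ N)                  ≈⟨ ℚ.toℚᵘ-homo-* (1ℚ - + 1 / N) (fromℕ N) ⟨
  toℚᵘ ((1ℚ - + 1 / N) * fromℕ N)                          ∎)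
  where
  open ℚᵘ.≃-Reasoning
  -- As `N` is `suc m`, the numerator of 1 - 1/N computes to `m + 0`; only units remain to be
  -- removed.
  cross-multiplied : (+ m) ℤ.* (+ (1 ℕ.* N ℕ.* 1)) ≡ ((+ 1 ℤ.* + N ℤ.+ (ℤ.- (+ 1)) ℤ.* + 1) ℤ.* + N) ℤ.* + 1
  cross-multiplied = trans
    (cong (λ z → + m ℤ.* + z) (trans (*-identityʳ (1 ℕ.* N)) (*-identityˡ N)))
    (sym (trans (ℤ.*-identityʳ _) (cong (λ z → + z ℤ.* + N) (+-identityʳ m))))

-- Coordinate axes and the optimal subspace.

inl : 𝔽₂^ m → 𝔽₂^ (m + n)
inl x = x ++ 𝟎

inr : 𝔽₂^ n → 𝔽₂^ (m + n)
inr x = 𝟎 ++ x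

inl-additive : Additive (inl {m} {n})
inl-additive x y = sym (trans (zipWith-++ _xor_ x 𝟎 y 𝟎) (cong ((x ⊕ y) ++_) (⊕-self 𝟎)))

inr-additive : Additive (inr {n} {m})
inr-additive {m = m} x y = sym (trans (zipWith-++ _xor_ (𝟎 {m}) x 𝟎 y) (cong (_++ (x ⊕ y)) (⊕-self 𝟎)))

axis : ∀ m → Fin 2 → 𝔽₂^ m → 𝔽₂^ (m + m)
axis m 0F = inl
axis m 1F = inr

axis-additive : ∀ m i → Additive (axis m i)
axis-additive m 0F = inl-additive
axis-additive m 1F = inr-additive

axis-injective : ∀ m i → Injective _≡_ _≡_ (axis m i)
axis-injective m 0F {x} {y} = ++-injectiveˡ x y
axis-injective m 1F         = ++-injectiveʳ (𝟎 {m}) 𝟎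

inl-take⊕inr-drop : ∀ m (x : 𝔽₂^ (m + n)) → inl (take m x) ⊕ inr (drop m x) ≡ x
inl-take⊕inr-drop m x = begin
  (take m x ++ 𝟎) ⊕ (𝟎 ++ drop m x)  ≡⟨ zipWith-++ _xor_ (take m x) 𝟎 𝟎 (drop m x) ⟩
  (take m x ⊕ 𝟎) ++ (𝟎 ⊕ drop m x)   ≡⟨ cong₂ _++_ (⊕-identityʳ (take m x)) (⊕-identityˡ (drop m x)) ⟩
  take m x ++ drop m x               ≡⟨ take++drop≡id m x ⟩
  x                                  ∎
  where open ≡-Reasoning

-- Parametrises the optimal subspace of vectors ((a , 0) , (b , 0)): the two halves of `z` are a and
-- b, so at most 2^(s + s) vectors arise.
corner : ∀ s r → 𝔽₂^ (s + s) → 𝔽₂^ ((s + r) + (s + r))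
corner s r z = inl (take s z) ++ inl (drop s z)

corner-additive : ∀ s r → Additive (corner s r)
corner-additive s r x y = begin
  inl (take s (x ⊕ y)) ++ inl (drop s (x ⊕ y))
    ≡⟨ cong₂ (λ a b → inl a ++ inl b) (take-zipWith {m = s} _xor_ x y) (drop-zipWith {m = s} _xor_ x y) ⟩
  inl (take s x ⊕ take s y) ++ inl (drop s x ⊕ drop s y)
    ≡⟨ cong₂ _++_ (inl-additive (take s x) (take s y)) (inl-additive (drop s x) (drop s y)) ⟩
  (inl (take s x) ⊕ inl (take s y)) ++ (inl (drop s x) ⊕ inl (drop s y))
    ≡⟨ zipWith-++ _xor_ (inl (take s x)) _ (inl (take s y)) _ ⟨
  corner s r x ⊕ corner s r y ∎
  where open ≡-Reasoning

corner-++ : ∀ s r (a b : 𝔽₂^ s) → corner s r (a ++ b) ≡ inl a ++ inl b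
corner-++ s r a b with p , q ← ++-injective (take s (a ++ b)) a (take++drop≡id s (a ++ b)) =
  cong₂ (λ a b → inl a ++ inl b) p q

module _ (s r : ℕ) where
  private
    ι : Fin 2 → 𝔽₂^ (s + r) → 𝔽₂^ ((s + r) + (s + r))
    ι = axis (s + r)

    V : Subset ((s + r) + (s + r))
    V = range (corner s r)

    inl𝟎≡𝟎 : inl {s} {r} 𝟎 ≡ 𝟎
    inl𝟎≡𝟎 = additive-𝟎 (inl-additive {s} {r})

  axis-inl∈corner : ∀ i (a : 𝔽₂^ s) → ι i (inl a) ∈ V
  axis-inl∈corner 0F a = subst (_∈ V)
    (trans (corner-++ s r a 𝟎) (cong (inl a ++_) inl𝟎≡𝟎)) (∈-range⁺ (corner s r) (a ++ 𝟎))
  axis-inl∈corner 1F a = subst (_∈ V)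
    (trans (corner-++ s r 𝟎 a) (cong (_++ inl {s} {r} a) inl𝟎≡𝟎)) (∈-range⁺ (corner s r) (𝟎 ++ a))

  -- Vectors of `V` vanish on the last `r` coordinates of each block, and on block `i` these
  -- coordinates spell out `y`.
  axis-inr-independent : ∀ i (y : 𝔽₂^ r) → ι i (inr y) ∈ V → y ≡ 𝟎
  axis-inr-independent i y p with ∈-range⁻ (corner s r) (ι i (inr y)) p
  axis-inr-independent 0F y _ | z , eq =
    ++-injectiveʳ 𝟎 (take s z) (++-injectiveˡ (inr y) (inl (take s z)) eq)
  axis-inr-independent 1F y _ | z , eq =
    ++-injectiveʳ 𝟎 (drop s z) (++-injectiveʳ 𝟎 (inl (take s z)) eq)

  -- An explicit complement, so that its dimension is known to be `r` and `𝒩-range` yields the exact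
  -- covering number 2^r on both axes.
  corner-complement : ∀ i → Complement V (ι i)
  corner-complement i = record
    { dim = r
    ; embed = ι i ∘ inr
    ; additive = λ x y → trans (cong (ι i) (inr-additive x y)) (axis-additive (s + r) i (inr x) (inr y))
    ; embed∈range = λ y → inr y , refl
    ; independent = axis-inr-independent i
    -- Removing the last `r` coordinates of `x` leaves a vector supported on the first `s`, whose
    -- image on either axis lies in `V`.
    ; spanning = λ x → drop s x , subst (_∈ V) (eq x) (axis-inl∈corner i (take s x))
    }
    where
    eq : ∀ x → ι i (inl (take s x)) ≡ ι i x ⊕ ι i (inr (drop s x))
    eq x = begin
      ι i a              ≡⟨ cong (ι i) (x⊕y⊕y≡x b a) ⟨
      ι i ((a ⊕ b) ⊕ b)  ≡⟨ cong (λ z → ι i (z ⊕ b)) (inl-take⊕inr-drop s x) ⟩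
      ι i (x ⊕ b)        ≡⟨ axis-additive (s + r) i x b ⟩
      ι i x ⊕ ι i b      ∎
      where
      open ≡-Reasoning
      a b : 𝔽₂^ (s + r)
      a = inl (take s x)
      b = inr (drop s x)

-- The example and its optimality.

theorem2p7 : ∀ (t : ℕ) → t ≥ 1 →
    Σ[ n ∈ ℕ ] Σ[ H ∈ (Fin 2 → Subset n) ] Σ[ B ∈ Subset n ]
    ( (∀ (i : Fin 2) → IsSubspace (H i))
    × ∣ H 0F ∣ ≡ ∣ H 1F ∣
    × Nonempty B
    × (∀ (i : Fin 2) →
    ∣ H i +ˢ H i ∣ ≡ ∣ H i ∣
    × fromℕ ∣ H i △ B ∣ ≡ (1ℚ - 2^- t) * fromℕ ∣ H i ∣)
    × IsMinimum
    (λ m → Σ[ V ∈ Subset n ]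
    ( IsSubspace V
    × ∣ V ∣ ≤ ∣ H 0F ∣
    × ∃[ a ] ∃[ b ] ( 𝒩 V ⟨ H 0F ⟩≐ a
    × 𝒩 V ⟨ H 1F ⟩≐ b
    × m ≡ a ⊔ b )))
    (2 ^ ⌈ t /2⌉) )
theorem2p7 t _ =
    d + d , H , B , H-sub , trans (∣H∣ 0F) (sym (∣H∣ 1F)) , (𝟎 , ∈-range⁺ o [])
  , (λ i → ∣V+V∣≡∣V∣ (H-sub i) , distance i)
  , ( V , V-sub , ∣V∣≤∣H∣ , 2 ^ r , 2 ^ r
    , 𝒩-range V-sub (corner-complement s r 0F) , 𝒩-range V-sub (corner-complement s r 1F)
    , sym (⊔-idem (2 ^ r)))
  , λ { _ (W , W-sub , ∣W∣≤ , a , b , 𝒩₀ , 𝒩₁ , refl) → lower-bound W W-sub ∣W∣≤ 𝒩₀ 𝒩₁ }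
  where
  s r d : ℕ
  s = ⌊ t /2⌋
  r = ⌈ t /2⌉
  -- Taking `s + r` instead of `t` makes the types fit `corner` without transport; `d≡t` is then
  -- applied only to exponents.
  d = s + r

  d≡t : d ≡ t
  d≡t = ⌊n/2⌋+⌈n/2⌉≡n t

  H : Fin 2 → Subset (d + d)
  H i = range (axis d i)

  H-sub : ∀ i → IsSubspace (H i)
  H-sub i = range-isSubspace (axis-additive d i)

  ∣H∣ : ∀ i → ∣ H i ∣ ≡ 2 ^ d
  ∣H∣ i = ∣range∣≡2^ (axis d i) (axis-injective d i)

  -- Presents {0} as the range of an injective additive map from the zero space, so that its size is
  -- 2^0.
  o : 𝔽₂^ 0 → 𝔽₂^ (d + d)
  o _ = 𝟎

  B : Subset (d + d)
  B = range o

  B⊆H : ∀ i → B ⊆ H i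
  B⊆H i x x∈B = subst (_∈ H i) (sym (proj₂ (∈-range⁻ o x x∈B))) (IsSubspace.𝟎-mem (H-sub i))

  ∣B∣≡1 : ∣ B ∣ ≡ 1
  ∣B∣≡1 = ∣range∣≡2^ o (λ { {[]} {[]} _ → refl })

  distance : ∀ i → fromℕ ∣ H i △ B ∣ ≡ (1ℚ - 2^- t) * fromℕ ∣ H i ∣
  distance i = trans
    -- With one element in `B`, the count for nested sets reads `suc ∣ H i △ B ∣ ≡ 2 ^ t`.
    (fromℕ-[1-1/N]*N _ (2 ^ t) {{m^n≢0 2 t}}
      (trans (cong (_+ ∣ H i △ B ∣) (sym ∣B∣≡1)) (trans (∣△∣ (H i) B (B⊆H i)) ∣H∣≡2^t)))
    (cong (λ h → (1ℚ - 2^- t) * fromℕ h) (sym ∣H∣≡2^t))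
    where
    ∣H∣≡2^t : ∣ H i ∣ ≡ 2 ^ t
    ∣H∣≡2^t = trans (∣H∣ i) (cong (2 ^_) d≡t)

  V : Subset (d + d)
  V = range (corner s r)

  V-sub : IsSubspace V
  V-sub = range-isSubspace (corner-additive s r)

  ∣V∣≤∣H∣ : ∣ V ∣ ≤ ∣ H 0F ∣
  ∣V∣≤∣H∣ = begin
    ∣ V ∣        ≤⟨ ∣range∣≤2^ (corner s r) ⟩
    2 ^ (s + s)  ≤⟨ ^-monoʳ-≤ 2 (+-monoʳ-≤ s (⌊n/2⌋≤⌈n/2⌉ t)) ⟩
    2 ^ (s + r)  ≡⟨ ∣H∣ 0F ⟨
    ∣ H 0F ∣     ∎
    where open ≤-Reasoning

  lower-bound : ∀ W → IsSubspace W → ∣ W ∣ ≤ ∣ H 0F ∣ →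
    ∀ {a b} → 𝒩 W ⟨ H 0F ⟩≐ a → 𝒩 W ⟨ H 1F ⟩≐ b → 2 ^ r ≤ a ⊔ b
  lower-bound W W-sub ∣W∣≤ {a} {b} 𝒩₀ 𝒩₁ = begin
    2 ^ r                        ≤⟨ ^-monoʳ-≤ 2 (⌈/2⌉≤⊔ {m = j₀} t≤j₀+j₁) ⟩
    2 ^ (j₀ ⊔ j₁)                ≡⟨ mono-≤-distrib-⊔ (^-monoʳ-≤ 2) j₀ j₁ ⟩
    2 ^ j₀ ⊔ 2 ^ j₁              ≤⟨ ⊔-mono-≤ (2^dim≤𝒩 W-sub G₀ 𝒩₀) (2^dim≤𝒩 W-sub G₁ 𝒩₁) ⟩
    a ⊔ b                        ∎
    where
    open ≤-Reasoning
    G₀ : Complement W (axis d 0F)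
    G₀ = complement W-sub (axis d 0F) (axis-additive d 0F)
    G₁ : Complement W (axis d 1F)
    G₁ = complement W-sub (axis d 1F) (axis-additive d 1F)
    j₀ j₁ : ℕ
    j₀ = Complement.dim G₀
    j₁ = Complement.dim G₁
    2^d*2^d≤ : 2 ^ d ℕ.* 2 ^ d ≤ 2 ^ (j₀ + j₁) ℕ.* 2 ^ d
    2^d*2^d≤ = begin
      2 ^ d ℕ.* 2 ^ d            ≡⟨ ^-distribˡ-+-* 2 d d ⟨
      2 ^ (d + d)                ≤⟨ complements-capacity G₀ G₁
                                      (λ x → take d x , drop d x , sym (inl-take⊕inr-drop d x)) W-sub ⟩
      2 ^ (j₀ + j₁) ℕ.* ∣ W ∣    ≤⟨ *-monoʳ-≤ (2 ^ (j₀ + j₁)) (≤-trans ∣W∣≤ (≤-reflexive (∣H∣ 0F))) ⟩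
      2 ^ (j₀ + j₁) ℕ.* 2 ^ d    ∎
    t≤j₀+j₁ : t ≤ j₀ + j₁
    t≤j₀+j₁ = subst (_≤ j₀ + j₁) d≡t
      (2^-cancel-≤ (*-cancelʳ-≤ (2 ^ d) _ (2 ^ d) {{m^n≢0 2 d}} 2^d*2^d≤))
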